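{- For every fixed integer $k\geqslant 3$, we have $D(n,k)=o(n^{k-1})$ as $n\to\infty$.
   Context: All graphs are finite, simple and undirected. For a graph $G$ and an integer $k\geq 1$, the $k$-configuration graph $\mathcal{R}_k(G)$ (token jumping model) is the graph whose vertices are the independent sets of $G$ of size exactly $k$, where two such independent sets $I,J$ are adjacent if and only if $|I\cap J|=k-1$ (i.e. $J$ is obtained from $I$ by removing one vertex and adding another vertex). $D(n,k)$ denotes the maximum, over all graphs $G$ on $n$ vertices, of the largest diameter of a connected component of $\mathcal{R}_k(G)$. -}

module Defs where

open import Data.Nat using (ℕ; zero; suc; _∸_; _≤_)
open import Data.Bool using (Bool; true; false)
open import Data.Fin using (Fin)
open import Data.Fin.Subset using (Subset; _∈_; _∩_; ∣_∣)
open import Data.Product using (Σ; ∃; _×_)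
open import Relation.Binary.PropositionalEquality using (_≡_)

record Graph (n : ℕ) : Set where
  field
    adj    : Fin n → Fin n → Bool
    sym    : ∀ u v → adj u v ≡ adj v u
    irrefl : ∀ u → adj u u ≡ false

module _ {n : ℕ} (G : Graph n) (k : ℕ) where

  Independent : Subset n → Set
  Independent I = ∀ u v → u ∈ I → v ∈ I → Graph.adj G u v ≡ false

  -- vertices of R_k(G): independent sets of size exactly k
  IsConfig : Subset n → Set
  IsConfig I = Independent I × ∣ I ∣ ≡ k

  -- adjacency in R_k(G) (token jumping): |I ∩ J| = k - 1
  TJAdj : Subset n → Subset n → Set
  TJAdj I J = ∣ I ∩ J ∣ ≡ k ∸ 1

  data Walk : Subset n → Subset n → ℕ → Set where
    here : ∀ {I} → IsConfig I → Walk I I 0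
    step : ∀ {I J L l} → IsConfig I → TJAdj I J → Walk J L l → Walk I L (suc l)

  ComponentDiamsAtMost : ℕ → Set
  ComponentDiamsAtMost b =
    ∀ I J l → Walk I J l → Σ ℕ (λ l′ → Walk I J l′ × l′ ≤ b)

DAtMost : ℕ → ℕ → ℕ → Set
DAtMost n k b = (G : Graph n) → ComponentDiamsAtMost G k b

{-# OPTIONS --safe #-}
-- On a geodesic of R_k(G), take every third configuration. Two of these never have a common neighbour,
-- so after fixing k - 3 of the vertices, the remaining triples {x, y, z} meet pairwise in at most one vertex,
-- and a triangle xy, xz, yz of pairs covered by triples is itself a triple (it spans a configuration adjacent
-- to the three covering ones). It remains to show the Ruzsa–Szemerédi bound o(n²) for such triple systems.
--
-- Suppose there are at least n²/m triples. Let E be the bipartite graph of the pairs yz, and let E_x be the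
-- matching of those pairs whose triple contains x; it is induced in E. Starting from all of Y × Z, sparse
-- rectangles are removed repeatedly, the removed set D always being a union of cells of two partitions of
-- bounded size. As D contains few edges, most triples xyz have yz outside D, and for most of these E_x covers
-- a constant proportion of the two cells A ∋ y, B ∋ z. The covered parts A′, B′ span a matching only, so
-- A′ × B′ is sparse and may be removed. Doing this in all such cells (A, B) at once enlarges D by a constant
-- fraction of n² and refines the partitions by one bit per cell of the other side. As |D| ≤ n², this must
-- stop after boundedly many rounds.
module Submission where

open import Defs
open import Data.Bool using (if_then_else_)
open import Data.Empty using (⊥)
open import Data.Fin using (Fin; zero; suc; toℕ; punchIn; combine; remQuot; funToFin; finToFun)
open import Data.Fin.Patterns using (0F; 1F; 2F)
open import Data.Fin.Properties using (_≟_; all?; any?; 0≢1+n; suc-injective; toℕ-injective; toℕ<n; injective⇒≤; punchIn-injective; punchInᵢ≢i; remQuot-combine; finToFun-funToFin)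
open import Data.Fin.Subset using (Subset; inside; outside; _∈_; _⊆_; _∩_; ∣_∣)
open import Data.Fin.Subset.Properties using (_∈?_; anySubset?; p⊂q⇒∣p∣<∣q∣; p∩q⊆p; p∩q⊆q; ⊆-antisym; ∩-comm; x∈p∩q⁺)
open import Data.Nat using (ℕ; zero; suc; _+_; _*_; _^_; _∸_; _⊔_; _≤_; _<_; z≤n; s≤s; s≤s⁻¹; _≤?_; _<?_; NonZero)
open import Data.Nat.DivMod using (_/_; _%_; m≡m%n+[m/n]*n; m%n<n; m/n*n≤m; m*n/n≡m; /-monoˡ-≤)
open import Data.Nat.Induction using (<-rec)
open import Data.Nat.Properties hiding (0≢1+n; suc-injective; _≟_; _≤?_; _<?_)
open import Data.Nat.Tactic.RingSolver using (solve-∀)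
open import Data.Product using (Σ; ∃; _×_; _,_; proj₁; proj₂)
open import Data.Sum using (_⊎_; inj₁; inj₂)
open import Data.Vec using (_∷_; tabulate; here; there)
open import Data.Vec.Properties using (≡-dec; lookup∘tabulate; []=⇒lookup; lookup⇒[]=)
open import Function using (_∘_)
open import Function.Definitions using (Injective)
open import Relation.Binary.PropositionalEquality using (_≡_; refl; sym; trans; cong; cong₂; subst; subst₂; module ≡-Reasoning)
open import Relation.Nullary using (¬_; Dec; yes; no; does; contradiction; _×-dec_; _⊎-dec_; _→-dec_; ¬?)
open import Relation.Unary using (Decidable)
import Data.Bool.Properties as Bool
import Data.Nat.Properties as ℕ

open import Algebra.Properties.Semiring.Sum +-*-semiring using (sum; sum-cong-≗; ∑-distrib-+; ∑-comm; *-distribˡ-sum; *-distribʳ-sum)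

private
  variable
    A B C : Set
    K n r : ℕ

-- Indicators and finite sums

𝟙 : Dec A → ℕ
𝟙 a? = if does a? then 1 else 0

𝟙-mono : (a? : Dec A) (b? : Dec B) → (A → B) → 𝟙 a? ≤ 𝟙 b?
𝟙-mono (no _)  _       _ = z≤n
𝟙-mono (yes _) (yes _) _ = ≤-refl
𝟙-mono (yes x) (no ¬y) f = contradiction (f x) ¬y

𝟙≤1 : (a? : Dec A) → 𝟙 a? ≤ 1
𝟙≤1 (yes _) = ≤-refl
𝟙≤1 (no _)  = z≤n

𝟙*≤ : (a? : Dec A) (k : ℕ) → 𝟙 a? * k ≤ k
𝟙*≤ (yes _) k = ≤-reflexive (*-identityˡ k)
𝟙*≤ (no _)  k = z≤n

𝟙-true : (a? : Dec A) → A → 𝟙 a? ≡ 1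
𝟙-true (yes _) _ = refl
𝟙-true (no ¬x) x = contradiction x ¬x

𝟙-false : (a? : Dec A) → ¬ A → 𝟙 a? ≡ 0
𝟙-false (no _)  _  = refl
𝟙-false (yes x) ¬x = contradiction x ¬x

𝟙-⊎ : (a? : Dec A) (b? : Dec B) (c? : Dec C) → ¬ (A × B) → (C → A ⊎ B) → (A ⊎ B → C) → 𝟙 c? ≡ 𝟙 a? + 𝟙 b?
𝟙-⊎ (yes x) (yes y) _       disj _ _ = contradiction (x , y) disj
𝟙-⊎ (yes x) (no _)  c?      _    _ g = 𝟙-true c? (g (inj₁ x))
𝟙-⊎ (no _)  (yes y) c?      _    _ g = 𝟙-true c? (g (inj₂ y))
𝟙-⊎ (no _)  (no _)  (no _)  _    _ _ = refl
𝟙-⊎ (no ¬x) (no ¬y) (yes z) _    f _ with f z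
... | inj₁ x = contradiction x ¬x
... | inj₂ y = contradiction y ¬y

𝟙-× : (a? : Dec A) (b? : Dec B) → 𝟙 (a? ×-dec b?) ≡ 𝟙 a? * 𝟙 b?
𝟙-× (yes _) (yes _) = refl
𝟙-× (yes _) (no _)  = refl
𝟙-× (no _)  _       = refl

-- ∑ is abstract so that unification can invert it even when its range is not yet known.
abstract
  ∑ : (Fin n → ℕ) → ℕ
  ∑ = sum

  ∑-cong : {f g : Fin n → ℕ} → (∀ i → f i ≡ g i) → ∑ f ≡ ∑ g
  ∑-cong = sum-cong-≗

  ∑-+ : (f g : Fin n → ℕ) → ∑ (λ i → f i + g i) ≡ ∑ f + ∑ g
  ∑-+ = ∑-distrib-+

  ∑-swap : (f : Fin n → Fin K → ℕ) → ∑ (λ i → ∑ (f i)) ≡ ∑ (λ j → ∑ λ i → f i j)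
  ∑-swap = ∑-comm

  *-∑ : (k : ℕ) (f : Fin n → ℕ) → k * ∑ f ≡ ∑ (λ i → k * f i)
  *-∑ = *-distribˡ-sum

  ∑-* : (k : ℕ) (f : Fin n → ℕ) → ∑ f * k ≡ ∑ (λ i → f i * k)
  ∑-* = *-distribʳ-sum

  ∑-mono : {f g : Fin n → ℕ} → (∀ i → f i ≤ g i) → ∑ f ≤ ∑ g
  ∑-mono {n = zero}  f≤g = z≤n
  ∑-mono {n = suc n} f≤g = +-mono-≤ (f≤g zero) (∑-mono (f≤g ∘ suc))

  ∑-const : ∀ n k → ∑ {n} (λ _ → k) ≡ n * k
  ∑-const zero    k = refl
  ∑-const (suc n) k = cong (k +_) (∑-const n k)

  ∑-zero : {f : Fin n → ℕ} → (∀ i → f i ≡ 0) → ∑ f ≡ 0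
  ∑-zero {n = n} f≡0 = trans (∑-cong f≡0) (trans (∑-const n 0) (*-zeroʳ n))

  ∑-δ : (c : Fin n) (h : Fin n → ℕ) → ∑ (λ i → 𝟙 (c ≟ i) * h i) ≡ h c
  ∑-δ {n = suc n} zero    h = trans (cong₂ _+_ (+-identityʳ (h zero)) (∑-zero {n} λ _ → refl)) (+-identityʳ (h zero))
  ∑-δ             (suc c) h = ∑-δ c (h ∘ suc)

  ∑-𝟙≤1 : {P : Fin n → Set} (P? : Decidable P) → (∀ i j → P i → P j → i ≡ j) → ∑ (λ i → 𝟙 (P? i)) ≤ 1
  ∑-𝟙≤1 {n = zero}  P? unique = z≤n
  ∑-𝟙≤1 {n = suc n} P? unique with P? zero
  ... | yes p = ≤-reflexive (cong suc (∑-zero λ i → 𝟙-false (P? (suc i)) λ q → 0≢1+n (unique zero (suc i) p q)))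
  ... | no _  = ∑-𝟙≤1 (P? ∘ suc) λ i j p q → suc-injective (unique (suc i) (suc j) p q)

∑≤n*k : {f : Fin n → ℕ} (k : ℕ) → (∀ i → f i ≤ k) → ∑ f ≤ n * k
∑≤n*k {n = n} k f≤k = ≤-trans (∑-mono f≤k) (≤-reflexive (∑-const n k))

∑-𝟙≤𝟙 : {P : Fin n → Set} (P? : Decidable P) (∃P? : Dec (∃ P)) → (∀ i j → P i → P j → i ≡ j) →
        ∑ (λ i → 𝟙 (P? i)) ≤ 𝟙 ∃P?
∑-𝟙≤𝟙 P? (yes _) unique = ∑-𝟙≤1 P? unique
∑-𝟙≤𝟙 P? (no ¬∃) unique = ≤-reflexive (∑-zero λ i → 𝟙-false (P? i) λ p → ¬∃ (i , p))

-- The cell is a separate argument of `h`, so whatever depends on the cell alone is constant in the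
-- inner sum and can be factored out.
∑-fibres : (P : Fin n → Fin K) (h : Fin K → Fin n → ℕ) →
             ∑ (λ y → h (P y) y) ≡ ∑ (λ i → ∑ λ y → 𝟙 (P y ≟ i) * h i y)
∑-fibres P h = trans (∑-cong λ y → sym (∑-δ (P y) λ i → h i y)) (∑-swap _)

∑-fibres₂ : (P Q : Fin n → Fin K) (h : Fin K → Fin K → Fin n → Fin n → ℕ) →
              ∑ (λ y → ∑ λ z → h (P y) (Q z) y z) ≡
              ∑ (λ i → ∑ λ j → ∑ λ y → 𝟙 (P y ≟ i) * ∑ λ z → 𝟙 (Q z ≟ j) * h i j y z)
∑-fibres₂ P Q h = begin
  ∑ (λ y → ∑ λ z → h (P y) (Q z) y z)
    ≡⟨ ∑-cong (λ y → ∑-fibres Q λ j z → h (P y) j y z) ⟩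
  ∑ (λ y → ∑ λ j → ∑ λ z → 𝟙 (Q z ≟ j) * h (P y) j y z)
    ≡⟨ ∑-fibres P (λ i y → ∑ λ j → ∑ λ z → 𝟙 (Q z ≟ j) * h i j y z) ⟩
  ∑ (λ i → ∑ λ y → 𝟙 (P y ≟ i) * ∑ λ j → ∑ λ z → 𝟙 (Q z ≟ j) * h i j y z)
    ≡⟨ ∑-cong (λ i → trans (∑-cong λ y → *-∑ (𝟙 (P y ≟ i)) _) (∑-swap _)) ⟩
  ∑ (λ i → ∑ λ j → ∑ λ y → 𝟙 (P y ≟ i) * ∑ λ z → 𝟙 (Q z ≟ j) * h i j y z) ∎
  where open ≡-Reasoning

-- Cells of a partition, and sets that cover little of a cell

cell : (Fin n → Fin K) → Fin K → ℕ
cell P i = ∑ λ y → 𝟙 (P y ≟ i)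

part : (Fin n → Fin K) → Fin K → {U : Fin n → Set} → Decidable U → ℕ
part P i U? = ∑ λ y → 𝟙 (P y ≟ i) * 𝟙 (U? y)

∑-cell : (P : Fin n → Fin K) → ∑ (cell P) ≡ n
∑-cell {n = n} P = begin
  ∑ (cell P)                              ≡⟨ ∑-cong (λ i → ∑-cong λ y → sym (*-identityʳ (𝟙 (P y ≟ i)))) ⟩
  ∑ (λ i → ∑ λ y → 𝟙 (P y ≟ i) * 1)     ≡⟨ sym (∑-fibres P λ _ _ → 1) ⟩
  ∑ {n} (λ _ → 1)                         ≡⟨ ∑-const n 1 ⟩
  n * 1                                     ≡⟨ *-identityʳ n ⟩
  n                                         ∎
  where open ≡-Reasoning

Light : (P : Fin n → Fin K) {U : Fin n → Set} → Decidable U → ℕ → Fin K → Set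
Light P U? d i = d * part P i U? < cell P i

light? : (P : Fin n → Fin K) {U : Fin n → Set} (U? : Decidable U) (d : ℕ) → Decidable (Light P U? d)
light? P U? d i = d * part P i U? <? cell P i

-- `U` has less than a 1/`d` share of each light cell, and the sizes of the cells add up to `n`.
light-bound : (P : Fin n → Fin K) {U : Fin n → Set} (U? : Decidable U) (d : ℕ) →
              d * ∑ (λ y → 𝟙 (U? y) * 𝟙 (light? P U? d (P y))) ≤ n
light-bound {n = n} P U? d = begin
  d * ∑ (λ y → 𝟙 (U? y) * 𝟙 (L? (P y)))
    ≡⟨ cong (d *_) (∑-fibres P λ i y → 𝟙 (U? y) * 𝟙 (L? i)) ⟩
  d * ∑ (λ i → ∑ λ y → 𝟙 (P y ≟ i) * (𝟙 (U? y) * 𝟙 (L? i)))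
    ≡⟨ cong (d *_) (∑-cong λ i → trans (∑-cong λ y → sym (*-assoc (𝟙 (P y ≟ i)) (𝟙 (U? y)) (𝟙 (L? i)))) (sym (∑-* (𝟙 (L? i)) _))) ⟩
  d * ∑ (λ i → part P i U? * 𝟙 (L? i))
    ≡⟨ *-∑ d _ ⟩
  ∑ (λ i → d * (part P i U? * 𝟙 (L? i)))
    ≤⟨ ∑-mono (λ i → below {part P i U?} (L? i)) ⟩
  ∑ (cell P)
    ≡⟨ ∑-cell P ⟩
  n ∎
  where
  open ≤-Reasoning
  L? = light? P U? d
  below : ∀ {p v} (l? : Dec (d * p < v)) → d * (p * 𝟙 l?) ≤ v
  below {p} (yes l) = ≤-trans (≤-reflexive (cong (d *_) (*-identityʳ p))) (<⇒≤ l)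
  below {p} (no _)  = ≤-trans (≤-reflexive (trans (cong (d *_) (*-zeroʳ p)) (*-zeroʳ d))) z≤n

-- Ruzsa–Szemerédi triple systems

∑³ : (Fin n → Fin n → Fin n → ℕ) → ℕ
∑³ f = ∑ λ x → ∑ λ y → ∑ λ z → f x y z

∑³-mono : {f g : Fin n → Fin n → Fin n → ℕ} → (∀ x y z → f x y z ≤ g x y z) → ∑³ f ≤ ∑³ g
∑³-mono f≤g = ∑-mono λ x → ∑-mono λ y → ∑-mono λ z → f≤g x y z

∑³-+ : (f g : Fin n → Fin n → Fin n → ℕ) → ∑³ (λ x y z → f x y z + g x y z) ≡ ∑³ f + ∑³ g
∑³-+ f g = trans (∑-cong λ x → trans (∑-cong λ y → ∑-+ _ _) (∑-+ _ _)) (∑-+ _ _)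

∑³-rotate : (f : Fin n → Fin n → Fin n → ℕ) → ∑³ f ≡ ∑³ (λ y z x → f x y z)
∑³-rotate f = trans (∑-swap _) (∑-cong λ y → ∑-swap _)

record TripleSystem (n : ℕ) : Set₁ where
  field
    T         : Fin n → Fin n → Fin n → Set
    T?        : ∀ x y z → Dec (T x y z)
    xy-unique : ∀ {x y z z′} → T x y z → T x y z′ → z ≡ z′
    xz-unique : ∀ {x y y′ z} → T x y z → T x y′ z → y ≡ y′
    yz-unique : ∀ {x x′ y z} → T x y z → T x′ y z → x ≡ x′
    closed    : ∀ {x y z x′ y′ z′} → T x y z′ → T x y′ z → T x′ y z → T x y z

  size : ℕ
  size = ∑³ λ x y z → 𝟙 (T? x y z)

  Left : Fin n → Fin n → Set
  Left x y = ∃ (T x y)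

  left? : ∀ x → Decidable (Left x)
  left? x y = any? (T? x y)

  Right : Fin n → Fin n → Set
  Right x z = ∃ λ y → T x y z

  right? : ∀ x → Decidable (Right x)
  right? x z = any? λ y → T? x y z

  -- By `yz-unique` this is 0 or 1, the indicator of an edge yz; written as a sum, it also counts
  -- triples.
  mult : Fin n → Fin n → ℕ
  mult y z = ∑ λ x → 𝟙 (T? x y z)

-- The colour of a vertex in a refined partition: its old colour and one bit per cell of the other side.
encode : Fin K → (Fin K → Fin 2) → Fin (K * 2 ^ K)
encode i f = combine i (funToFin f)

colour : ∀ K → Fin (K * 2 ^ K) → Fin K
colour K c = proj₁ (remQuot {K} (2 ^ K) c)

mark : ∀ K → Fin (K * 2 ^ K) → Fin K → Fin 2
mark K c = finToFun (proj₂ (remQuot {K} (2 ^ K) c))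

colour-encode : ∀ {K} (i : Fin K) (f : Fin K → Fin 2) → colour K (encode i f) ≡ i
colour-encode i f = cong proj₁ (remQuot-combine i (funToFin f))

mark-encode : ∀ {K} (i : Fin K) (f : Fin K → Fin 2) (j : Fin K) → mark K (encode i f) j ≡ f j
mark-encode i f j = trans (cong (λ c → finToFun (proj₂ c) j) (remQuot-combine i (funToFin f))) (finToFun-funToFin f j)

bit : Dec A → Fin 2
bit a? = if does a? then 1F else 0F

bit⁻ : (a? : Dec A) → bit a? ≡ 1F → A
bit⁻ (yes x) _ = x

bit⁺ : (a? : Dec A) → A → bit a? ≡ 1F
bit⁺ (yes _) _ = refl
bit⁺ (no ¬x) x = contradiction x ¬x

edges : (S : TripleSystem n) (P Q : Fin n → Fin K) {D : Fin K → Fin K → Set} → (∀ i j → Dec (D i j)) → ℕ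
edges S P Q D? = ∑ λ y → ∑ λ z → 𝟙 (D? (P y) (Q z)) * TripleSystem.mult S y z

area : (P Q : Fin n → Fin K) {D : Fin K → Fin K → Set} → (∀ i j → Dec (D i j)) → ℕ
area P Q D? = ∑ λ y → ∑ λ z → 𝟙 (D? (P y) (Q z))

area≤n*n : (P Q : Fin n → Fin K) {D : Fin K → Fin K → Set} (D? : ∀ i j → Dec (D i j)) → area P Q D? ≤ n * n
area≤n*n {n = n} P Q D? = ∑≤n*k n λ y → ≤-trans (∑≤n*k 1 λ z → 𝟙≤1 (D? (P y) (Q z))) (≤-reflexive (*-identityʳ n))

-- One round of removal

module Refine {n K : ℕ} (S : TripleSystem n) (d : ℕ) (d≢0 : NonZero d) (P Q : Fin n → Fin K) (D : Fin K → Fin K → Set) (D? : ∀ i j → Dec (D i j)) where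

  open TripleSystem S

  -- The bound `d * d ≤ cell Q j` leaves at least `d` covered vertices on the right, enough for a
  -- matching to have density at most 1/`d`.
  Good : Fin K → Fin K → Fin n → Set
  Good i j x = ¬ D i j × ¬ Light P (left? x) d i × ¬ Light Q (right? x) d j × d * d ≤ cell Q j

  W : Fin K → Fin K → Set
  W i j = ∃ (Good i j)

  W? : ∀ i j → Dec (W i j)
  W? i j = any? λ x → ¬? (D? i j) ×-dec ¬? (light? P (left? x) d i) ×-dec ¬? (light? Q (right? x) d j) ×-dec (d * d ≤? cell Q j)

  -- The decision is an argument, so that matching on it exposes the chosen `x`, common to the whole
  -- cell pair. Outside `W` the set is empty, so that sums may run over all cell pairs.
  LeftOf : ∀ {i j} → Dec (W i j) → Fin n → Set
  LeftOf (yes (x , _)) = Left x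
  LeftOf (no _)        = λ _ → ⊥

  leftOf? : ∀ {i j} (w? : Dec (W i j)) → Decidable (LeftOf w?)
  leftOf? (yes (x , _)) = left? x
  leftOf? (no _)        = λ _ → no λ ()

  RightOf : ∀ {i j} → Dec (W i j) → Fin n → Set
  RightOf (yes (x , _)) = Right x
  RightOf (no _)        = λ _ → ⊥

  rightOf? : ∀ {i j} (w? : Dec (W i j)) → Decidable (RightOf w?)
  rightOf? (yes (x , _)) = right? x
  rightOf? (no _)        = λ _ → no λ ()

  -- Neither cell is light, so each covered part has at least a 1/`d` share of its cell.
  cell-area : ∀ {i j} (w? : Dec (W i j)) →
              𝟙 w? * (cell P i * cell Q j) ≤ d * d * (part P i (leftOf? w?) * part Q j (rightOf? w?))
  cell-area (no _) = z≤n
  cell-area {i} {j} (yes (x , _ , heavyˡ , heavyʳ , _)) = begin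
    1 * (cell P i * cell Q j)   ≡⟨ *-identityˡ _ ⟩
    cell P i * cell Q j         ≤⟨ *-mono-≤ (≮⇒≥ heavyˡ) (≮⇒≥ heavyʳ) ⟩
    (d * u) * (d * v)           ≡⟨ rearrange d u v ⟩
    d * d * (u * v)             ∎
    where
    open ≤-Reasoning
    u = part P i (left? x)
    v = part Q j (right? x)
    rearrange : ∀ d u v → (d * u) * (d * v) ≡ d * d * (u * v)
    rearrange = solve-∀

  -- The matching of `x` is induced: if it covers `y` and `z` and some triple contains yz, then
  -- `closed` makes xyz a triple.
  mult≤𝟙 : ∀ x y z → 𝟙 (left? x y) * (𝟙 (right? x z) * mult y z) ≤ 𝟙 (left? x y) * 𝟙 (T? x y z)
  mult≤𝟙 x y z = bound (left? x y) (right? x z)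
    where
    bound : (l? : Dec (Left x y)) (r? : Dec (Right x z)) → 𝟙 l? * (𝟙 r? * mult y z) ≤ 𝟙 l? * 𝟙 (T? x y z)
    bound (no _)        _              = z≤n
    bound (yes _)       (no _)         = z≤n
    bound (yes (_ , t)) (yes (_ , t′)) = *-monoʳ-≤ 1 (begin
      1 * mult y z         ≡⟨ *-identityˡ _ ⟩
      mult y z             ≤⟨ ∑-𝟙≤𝟙 (λ x′ → T? x′ y z) (any? λ x′ → T? x′ y z) (λ _ _ → yz-unique) ⟩
      𝟙 (any? λ x′ → T? x′ y z) ≤⟨ 𝟙-mono (any? λ x′ → T? x′ y z) (T? x y z) (λ (_ , t″) → closed t t′ t″) ⟩
      𝟙 (T? x y z)         ∎)
      where open ≤-Reasoning

  -- Each covered vertex on the left has at most one edge into the covered part on the right, and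
  -- that part has at least `d` vertices.
  cell-sparse : ∀ {i j} (w? : Dec (W i j)) →
                d * ∑ (λ y → 𝟙 (P y ≟ i) * ∑ λ z → 𝟙 (Q z ≟ j) * (𝟙 (leftOf? w? y) * (𝟙 (rightOf? w? z) * mult y z)))
                ≤ part P i (leftOf? w?) * part Q j (rightOf? w?)
  cell-sparse {i} {j} (no _) = ≤-trans (≤-reflexive (trans (cong (d *_) (∑-zero λ y → trans (cong (𝟙 (P y ≟ i) *_) (∑-zero λ z → *-zeroʳ (𝟙 (Q z ≟ j)))) (*-zeroʳ (𝟙 (P y ≟ i))))) (*-zeroʳ d))) z≤n
  cell-sparse {i} {j} (yes (x , _ , _ , heavyʳ , big)) = begin
    d * ∑ (λ y → 𝟙 (P y ≟ i) * ∑ λ z → 𝟙 (Q z ≟ j) * (𝟙 (left? x y) * (𝟙 (right? x z) * mult y z)))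
      ≤⟨ *-monoʳ-≤ d (∑-mono λ y → *-monoʳ-≤ (𝟙 (P y ≟ i)) (row y)) ⟩
    d * u
      -- `big` and `heavyʳ` give `d * d ≤ cell Q j ≤ d * v`, and cancelling `d` leaves `d ≤ v`.
      ≤⟨ *-monoˡ-≤ u (*-cancelˡ-≤ d {{d≢0}} (≤-trans big (≮⇒≥ heavyʳ))) ⟩
    v * u
      ≡⟨ *-comm v u ⟩
    u * v ∎
    where
    open ≤-Reasoning
    u = part P i (left? x)
    v = part Q j (right? x)
    row : ∀ y → ∑ (λ z → 𝟙 (Q z ≟ j) * (𝟙 (left? x y) * (𝟙 (right? x z) * mult y z))) ≤ 𝟙 (left? x y)
    row y = begin
      ∑ (λ z → 𝟙 (Q z ≟ j) * (𝟙 (left? x y) * (𝟙 (right? x z) * mult y z)))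
        ≤⟨ ∑-mono (λ z → ≤-trans (𝟙*≤ (Q z ≟ j) _) (mult≤𝟙 x y z)) ⟩
      ∑ (λ z → 𝟙 (left? x y) * 𝟙 (T? x y z))
        ≡⟨ sym (*-∑ (𝟙 (left? x y)) _) ⟩
      𝟙 (left? x y) * ∑ (λ z → 𝟙 (T? x y z))
        ≤⟨ *-monoʳ-≤ (𝟙 (left? x y)) (∑-𝟙≤1 (T? x y) λ _ _ → xy-unique) ⟩
      𝟙 (left? x y) * 1
        ≡⟨ *-identityʳ _ ⟩
      𝟙 (left? x y) ∎

  wArea gain gainEdges : ℕ
  wArea     = area P Q W?
  gain      = ∑ λ y → ∑ λ z → 𝟙 (leftOf? (W? (P y) (Q z)) y) * 𝟙 (rightOf? (W? (P y) (Q z)) z)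
  gainEdges = ∑ λ y → ∑ λ z → 𝟙 (leftOf? (W? (P y) (Q z)) y) * (𝟙 (rightOf? (W? (P y) (Q z)) z) * mult y z)

  ∑-product : (i j : Fin K) (f g : Fin n → ℕ) →
              ∑ (λ y → 𝟙 (P y ≟ i) * ∑ λ z → 𝟙 (Q z ≟ j) * (f y * g z)) ≡
              ∑ (λ y → 𝟙 (P y ≟ i) * f y) * ∑ (λ z → 𝟙 (Q z ≟ j) * g z)
  ∑-product i j f g = begin
    ∑ (λ y → 𝟙 (P y ≟ i) * ∑ λ z → 𝟙 (Q z ≟ j) * (f y * g z))
      ≡⟨ ∑-cong (λ y → cong (𝟙 (P y ≟ i) *_) (trans (∑-cong λ z → exchange (𝟙 (Q z ≟ j)) (f y) (g z)) (sym (*-∑ (f y) _)))) ⟩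
    ∑ (λ y → 𝟙 (P y ≟ i) * (f y * v))
      ≡⟨ ∑-cong (λ y → sym (*-assoc (𝟙 (P y ≟ i)) (f y) v)) ⟩
    ∑ (λ y → 𝟙 (P y ≟ i) * f y * v)
      ≡⟨ sym (∑-* v _) ⟩
    ∑ (λ y → 𝟙 (P y ≟ i) * f y) * v ∎
    where
    open ≡-Reasoning
    v = ∑ (λ z → 𝟙 (Q z ≟ j) * g z)
    exchange : ∀ a b c → a * (b * c) ≡ b * (a * c)
    exchange = solve-∀

  gain-cells : gain ≡ ∑ λ i → ∑ λ j → part P i (leftOf? (W? i j)) * part Q j (rightOf? (W? i j))
  gain-cells = trans
    (∑-fibres₂ P Q λ i j y z → 𝟙 (leftOf? (W? i j) y) * 𝟙 (rightOf? (W? i j) z))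
    (∑-cong λ i → ∑-cong λ j → ∑-product i j (λ y → 𝟙 (leftOf? (W? i j) y)) (λ z → 𝟙 (rightOf? (W? i j) z)))

  wArea-cells : wArea ≡ ∑ λ i → ∑ λ j → 𝟙 (W? i j) * (cell P i * cell Q j)
  wArea-cells = begin
    wArea
      ≡⟨ ∑-fibres₂ P Q (λ i j _ _ → 𝟙 (W? i j)) ⟩
    ∑ (λ i → ∑ λ j → ∑ λ y → 𝟙 (P y ≟ i) * ∑ λ z → 𝟙 (Q z ≟ j) * 𝟙 (W? i j))
      ≡⟨ ∑-cong (λ i → ∑-cong λ j → per-cell i j) ⟩
    ∑ (λ i → ∑ λ j → 𝟙 (W? i j) * (cell P i * cell Q j)) ∎
    where
    open ≡-Reasoning
    rearrange : ∀ p q w → p * (q * w) ≡ w * (p * q)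
    rearrange = solve-∀
    per-cell : ∀ i j → ∑ (λ y → 𝟙 (P y ≟ i) * ∑ λ z → 𝟙 (Q z ≟ j) * 𝟙 (W? i j)) ≡ 𝟙 (W? i j) * (cell P i * cell Q j)
    per-cell i j = begin
      ∑ (λ y → 𝟙 (P y ≟ i) * ∑ λ z → 𝟙 (Q z ≟ j) * 𝟙 (W? i j))
        ≡⟨ ∑-cong (λ y → cong (𝟙 (P y ≟ i) *_) (sym (∑-* (𝟙 (W? i j)) _))) ⟩
      ∑ (λ y → 𝟙 (P y ≟ i) * (cell Q j * 𝟙 (W? i j)))
        ≡⟨ sym (∑-* (cell Q j * 𝟙 (W? i j)) _) ⟩
      cell P i * (cell Q j * 𝟙 (W? i j))
        ≡⟨ rearrange (cell P i) (cell Q j) (𝟙 (W? i j)) ⟩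
      𝟙 (W? i j) * (cell P i * cell Q j) ∎

  wArea≤gain : wArea ≤ d * d * gain
  wArea≤gain = begin
    wArea                                                          ≡⟨ wArea-cells ⟩
    ∑ (λ i → ∑ λ j → 𝟙 (W? i j) * (cell P i * cell Q j))           ≤⟨ ∑-mono (λ i → ∑-mono λ j → cell-area (W? i j)) ⟩
    ∑ (λ i → ∑ λ j → d * d * (part P i (leftOf? (W? i j)) * part Q j (rightOf? (W? i j))))
      ≡⟨ ∑-cong (λ i → sym (*-∑ (d * d) _)) ⟩
    ∑ (λ i → d * d * ∑ λ j → part P i (leftOf? (W? i j)) * part Q j (rightOf? (W? i j)))
      ≡⟨ sym (*-∑ (d * d) _) ⟩
    d * d * ∑ (λ i → ∑ λ j → part P i (leftOf? (W? i j)) * part Q j (rightOf? (W? i j)))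
      ≡⟨ cong (d * d *_) (sym gain-cells) ⟩
    d * d * gain ∎
    where open ≤-Reasoning

  gain-sparse : d * gainEdges ≤ gain
  gain-sparse = begin
    d * gainEdges
      ≡⟨ cong (d *_) (∑-fibres₂ P Q λ i j y z → 𝟙 (leftOf? (W? i j) y) * (𝟙 (rightOf? (W? i j) z) * mult y z)) ⟩
    d * ∑ (λ i → ∑ λ j → inner i j)
      ≡⟨ trans (*-∑ d _) (∑-cong λ i → *-∑ d _) ⟩
    ∑ (λ i → ∑ λ j → d * inner i j)
      ≤⟨ ∑-mono (λ i → ∑-mono λ j → cell-sparse (W? i j)) ⟩
    ∑ (λ i → ∑ λ j → part P i (leftOf? (W? i j)) * part Q j (rightOf? (W? i j)))
      ≡⟨ sym gain-cells ⟩
    gain ∎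
    where
    open ≤-Reasoning
    inner : Fin K → Fin K → ℕ
    inner i j = ∑ λ y → 𝟙 (P y ≟ i) * ∑ λ z → 𝟙 (Q z ≟ j) * (𝟙 (leftOf? (W? i j) y) * (𝟙 (rightOf? (W? i j) z) * mult y z))

  P′ : Fin n → Fin (K * 2 ^ K)
  P′ y = encode (P y) λ j → bit (leftOf? (W? (P y) j) y)

  Q′ : Fin n → Fin (K * 2 ^ K)
  Q′ z = encode (Q z) λ i → bit (rightOf? (W? i (Q z)) z)

  -- A pair lies in a new rectangle when each end is marked for the old cell of the other end. This
  -- is read off the new colours, so the removed set is again a union of cell pairs.
  D′ : Fin (K * 2 ^ K) → Fin (K * 2 ^ K) → Set
  D′ c e = D (colour K c) (colour K e) ⊎ mark K c (colour K e) ≡ 1F × mark K e (colour K c) ≡ 1F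

  D′? : ∀ c e → Dec (D′ c e)
  D′? c e = D? (colour K c) (colour K e) ⊎-dec (mark K c (colour K e) ≟ 1F ×-dec mark K e (colour K c) ≟ 1F)

  -- The two alternatives of `D′` exclude each other because `Good` rules out `D`; hence areas and
  -- edges simply add.
  𝟙-D′ : ∀ y z → 𝟙 (D′? (P′ y) (Q′ z)) ≡
         𝟙 (D? (P y) (Q z)) + 𝟙 (leftOf? (W? (P y) (Q z)) y) * 𝟙 (rightOf? (W? (P y) (Q z)) z)
  𝟙-D′ y z = trans
    (𝟙-⊎ (D? i j) (l? ×-dec r?) (D′? (P′ y) (Q′ z)) (λ (δ , l , _) → disjoint (W? i j) δ l) to from)
    (cong (𝟙 (D? i j) +_) (𝟙-× l? r?))
    where
    i = P y
    j = Q z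
    l? = leftOf? (W? i j) y
    r? = rightOf? (W? i j) z
    fˡ : Fin K → Fin 2
    fˡ j = bit (leftOf? (W? (P y) j) y)
    fʳ : Fin K → Fin 2
    fʳ i = bit (rightOf? (W? i (Q z)) z)
    disjoint : ∀ {i j} (w? : Dec (W i j)) → D i j → ¬ LeftOf w? y
    disjoint (yes (_ , ¬δ , _)) δ _ = ¬δ δ
    eqˡ : mark K (P′ y) (colour K (Q′ z)) ≡ bit l?
    eqˡ = trans (mark-encode i fˡ _) (cong fˡ (colour-encode j fʳ))
    eqʳ : mark K (Q′ z) (colour K (P′ y)) ≡ bit r?
    eqʳ = trans (mark-encode j fʳ _) (cong fʳ (colour-encode i fˡ))
    to : D′ (P′ y) (Q′ z) → D i j ⊎ LeftOf (W? i j) y × RightOf (W? i j) z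
    to (inj₁ δ)       = inj₁ (subst₂ D (colour-encode i fˡ) (colour-encode j fʳ) δ)
    to (inj₂ (l , r)) = inj₂ (bit⁻ l? (trans (sym eqˡ) l) , bit⁻ r? (trans (sym eqʳ) r))
    from : D i j ⊎ LeftOf (W? i j) y × RightOf (W? i j) z → D′ (P′ y) (Q′ z)
    from (inj₁ δ)       = inj₁ (subst₂ D (sym (colour-encode i fˡ)) (sym (colour-encode j fʳ)) δ)
    from (inj₂ (l , r)) = inj₂ (trans eqˡ (bit⁺ l? l) , trans eqʳ (bit⁺ r? r))

  area′ : area P′ Q′ D′? ≡ area P Q D? + gain
  area′ = trans (∑-cong λ y → trans (∑-cong λ z → 𝟙-D′ y z) (∑-+ _ _)) (∑-+ _ _)

  edges′ : edges S P′ Q′ D′? ≡ edges S P Q D? + gainEdges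
  edges′ = trans (∑-cong λ y → trans (∑-cong λ z → expand y z) (∑-+ _ _)) (∑-+ _ _)
    where
    distrib : ∀ a b c e → (a + b * c) * e ≡ a * e + b * (c * e)
    distrib = solve-∀
    expand : ∀ y z → 𝟙 (D′? (P′ y) (Q′ z)) * mult y z ≡
             𝟙 (D? (P y) (Q z)) * mult y z + 𝟙 (leftOf? (W? (P y) (Q z)) y) * (𝟙 (rightOf? (W? (P y) (Q z)) z) * mult y z)
    expand y z = trans (cong (_* mult y z) (𝟙-D′ y z))
      (distrib (𝟙 (D? (P y) (Q z))) (𝟙 (leftOf? (W? (P y) (Q z)) y)) (𝟙 (rightOf? (W? (P y) (Q z)) z)) (mult y z))

  Thin : Fin K → Set
  Thin j = cell Q j < d * d

  thin? : Decidable Thin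
  thin? j = cell Q j <? d * d

  mult≤1 : ∀ y z → mult y z ≤ 1
  mult≤1 y z = ∑-𝟙≤1 (λ x → T? x y z) λ _ _ → yz-unique

  -- The triples xyz for which `x` itself fails a condition of `Good` at the cells of `y` and `z`,
  -- one sum per condition; those inside `D` are counted by `edges`.
  leftLoss rightLoss thinLoss : ℕ
  leftLoss  = ∑³ λ x y z → 𝟙 (T? x y z) * 𝟙 (light? P (left? x) d (P y))
  rightLoss = ∑³ λ x y z → 𝟙 (T? x y z) * 𝟙 (light? Q (right? x) d (Q z))
  thinLoss  = ∑³ λ x y z → 𝟙 (T? x y z) * 𝟙 (thin? (Q z))

  -- For fixed `x`, each `y` lies in at most one triple, so `light-bound` applies to the set of
  -- covered `y`.
  leftLoss-bound : d * leftLoss ≤ n * n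
  leftLoss-bound = begin
    d * leftLoss
      ≡⟨ *-∑ d _ ⟩
    ∑ (λ x → d * ∑ λ y → ∑ λ z → 𝟙 (T? x y z) * 𝟙 (light? P (left? x) d (P y)))
      ≤⟨ ∑≤n*k n (λ x → ≤-trans (*-monoʳ-≤ d (∑-mono λ y → row x y)) (light-bound P (left? x) d)) ⟩
    n * n ∎
    where
    open ≤-Reasoning
    row : ∀ x y → ∑ (λ z → 𝟙 (T? x y z) * 𝟙 (light? P (left? x) d (P y))) ≤ 𝟙 (left? x y) * 𝟙 (light? P (left? x) d (P y))
    row x y = ≤-trans (≤-reflexive (sym (∑-* (𝟙 (light? P (left? x) d (P y))) _)))
      (*-monoˡ-≤ (𝟙 (light? P (left? x) d (P y))) (∑-𝟙≤𝟙 (T? x y) (left? x y) λ _ _ → xy-unique))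

  rightLoss-bound : d * rightLoss ≤ n * n
  rightLoss-bound = begin
    d * rightLoss
      ≡⟨ trans (cong (d *_) (∑-cong λ x → ∑-swap _)) (*-∑ d _) ⟩
    ∑ (λ x → d * ∑ λ z → ∑ λ y → 𝟙 (T? x y z) * 𝟙 (light? Q (right? x) d (Q z)))
      ≤⟨ ∑≤n*k n (λ x → ≤-trans (*-monoʳ-≤ d (∑-mono λ z → column x z)) (light-bound Q (right? x) d)) ⟩
    n * n ∎
    where
    open ≤-Reasoning
    column : ∀ x z → ∑ (λ y → 𝟙 (T? x y z) * 𝟙 (light? Q (right? x) d (Q z))) ≤ 𝟙 (right? x z) * 𝟙 (light? Q (right? x) d (Q z))
    column x z = ≤-trans (≤-reflexive (sym (∑-* (𝟙 (light? Q (right? x) d (Q z))) _)))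
      (*-monoˡ-≤ (𝟙 (light? Q (right? x) d (Q z))) (∑-𝟙≤𝟙 (λ y → T? x y z) (right? x z) λ _ _ → xz-unique))

  -- For fixed `x`, each `z` lies in at most one triple, and the at most `K` thin cells have fewer
  -- than `d * d` vertices each.
  thinLoss-bound : thinLoss ≤ n * (K * (d * d))
  thinLoss-bound = begin
    thinLoss
      ≡⟨ ∑-cong (λ x → ∑-swap _) ⟩
    ∑ (λ x → ∑ λ z → ∑ λ y → 𝟙 (T? x y z) * 𝟙 (thin? (Q z)))
      ≤⟨ ∑≤n*k (K * (d * d)) (λ x → ≤-trans (∑-mono λ z → column x z) thin-vertices) ⟩
    n * (K * (d * d)) ∎
    where
    open ≤-Reasoning
    column : ∀ x z → ∑ (λ y → 𝟙 (T? x y z) * 𝟙 (thin? (Q z))) ≤ 𝟙 (thin? (Q z))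
    column x z = begin
      ∑ (λ y → 𝟙 (T? x y z) * 𝟙 (thin? (Q z)))  ≡⟨ sym (∑-* (𝟙 (thin? (Q z))) _) ⟩
      ∑ (λ y → 𝟙 (T? x y z)) * 𝟙 (thin? (Q z))  ≤⟨ *-monoˡ-≤ (𝟙 (thin? (Q z))) (∑-𝟙≤1 (λ y → T? x y z) λ _ _ → xz-unique) ⟩
      1 * 𝟙 (thin? (Q z))                       ≡⟨ *-identityˡ _ ⟩
      𝟙 (thin? (Q z))                           ∎
    cell*𝟙 : ∀ {j} (t? : Dec (Thin j)) → cell Q j * 𝟙 t? ≤ d * d
    cell*𝟙 {j} (yes t) = ≤-trans (≤-reflexive (*-identityʳ (cell Q j))) (<⇒≤ t)
    cell*𝟙 {j} (no _)  = ≤-trans (≤-reflexive (*-zeroʳ (cell Q j))) z≤n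
    thin-vertices : ∑ (λ z → 𝟙 (thin? (Q z))) ≤ K * (d * d)
    thin-vertices = begin
      ∑ (λ z → 𝟙 (thin? (Q z)))                            ≡⟨ ∑-fibres Q (λ j _ → 𝟙 (thin? j)) ⟩
      ∑ (λ j → ∑ λ z → 𝟙 (Q z ≟ j) * 𝟙 (thin? j))          ≡⟨ ∑-cong (λ j → sym (∑-* (𝟙 (thin? j)) _)) ⟩
      ∑ (λ j → cell Q j * 𝟙 (thin? j))                     ≤⟨ ∑≤n*k (d * d) (λ j → cell*𝟙 (thin? j)) ⟩
      K * (d * d)                                          ∎

  -- A triple that escapes all four losses witnesses that its cell is in W.
  covered : ∀ x i j → 1 ≤ 𝟙 (D? i j) + (𝟙 (light? P (left? x) d i) + (𝟙 (light? Q (right? x) d j) + (𝟙 (thin? j) + 𝟙 (W? i j))))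
  covered x i j = cases (D? i j) (light? P (left? x) d i) (light? Q (right? x) d j) (thin? j)
    where
    cases : (δ? : Dec (D i j)) (l? : Dec (Light P (left? x) d i)) (r? : Dec (Light Q (right? x) d j)) (t? : Dec (Thin j)) →
            1 ≤ 𝟙 δ? + (𝟙 l? + (𝟙 r? + (𝟙 t? + 𝟙 (W? i j))))
    cases (yes _) _       _       _       = s≤s z≤n
    cases (no _)  (yes _) _       _       = s≤s z≤n
    cases (no _)  (no _)  (yes _) _       = s≤s z≤n
    cases (no _)  (no _)  (no _)  (yes _) = s≤s z≤n
    cases (no ¬δ) (no ¬l) (no ¬r) (no ¬t) = ≤-reflexive (sym (𝟙-true (W? i j) (x , ¬δ , ¬l , ¬r , ≮⇒≥ ¬t)))

  -- Every triple is charged to a term of `covered`. By `yz-unique`, the triples over `W` are no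
  -- more than the pairs yz there.
  size-bound : size ≤ edges S P Q D? + (leftLoss + (rightLoss + (thinLoss + wArea)))
  size-bound = begin
    size
      ≤⟨ ∑³-mono (λ x y z → pointwise x y z) ⟩
    ∑³ (λ x y z → t x y z * 𝟙 (D? (P y) (Q z)) + (t x y z * 𝟙 (light? P (left? x) d (P y)) + (t x y z * 𝟙 (light? Q (right? x) d (Q z)) + (t x y z * 𝟙 (thin? (Q z)) + t x y z * 𝟙 (W? (P y) (Q z))))))
      ≡⟨ trans (∑³-+ _ _) (cong (removed +_) (trans (∑³-+ _ _) (cong (leftLoss +_) (trans (∑³-+ _ _) (cong (rightLoss +_) (∑³-+ _ _)))))) ⟩
    removed + (leftLoss + (rightLoss + (thinLoss + ∑³ (λ x y z → t x y z * 𝟙 (W? (P y) (Q z))))))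
      ≤⟨ +-mono-≤ (≤-reflexive on-D) (+-monoʳ-≤ leftLoss (+-monoʳ-≤ rightLoss (+-monoʳ-≤ thinLoss on-W))) ⟩
    edges S P Q D? + (leftLoss + (rightLoss + (thinLoss + wArea))) ∎
    where
    open ≤-Reasoning
    t : Fin n → Fin n → Fin n → ℕ
    t x y z = 𝟙 (T? x y z)
    expand : ∀ t a b c e f → t * (a + (b + (c + (e + f)))) ≡ t * a + (t * b + (t * c + (t * e + t * f)))
    expand = solve-∀
    pointwise : ∀ x y z → t x y z ≤ t x y z * 𝟙 (D? (P y) (Q z)) + (t x y z * 𝟙 (light? P (left? x) d (P y)) + (t x y z * 𝟙 (light? Q (right? x) d (Q z)) + (t x y z * 𝟙 (thin? (Q z)) + t x y z * 𝟙 (W? (P y) (Q z)))))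
    pointwise x y z = ≤-trans (≤-reflexive (sym (*-identityʳ (t x y z))))
      (≤-trans (*-monoʳ-≤ (t x y z) (covered x (P y) (Q z)))
        (≤-reflexive (expand (t x y z) (𝟙 (D? (P y) (Q z))) (𝟙 (light? P (left? x) d (P y))) (𝟙 (light? Q (right? x) d (Q z))) (𝟙 (thin? (Q z))) (𝟙 (W? (P y) (Q z))))))
    removed : ℕ
    removed = ∑³ λ x y z → t x y z * 𝟙 (D? (P y) (Q z))
    on-D : removed ≡ edges S P Q D?
    on-D = trans (∑³-rotate _) (∑-cong λ y → ∑-cong λ z → trans (sym (∑-* (𝟙 (D? (P y) (Q z))) _)) (*-comm (mult y z) _))
    on-W : ∑³ (λ x y z → t x y z * 𝟙 (W? (P y) (Q z))) ≤ wArea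
    on-W = ≤-trans (≤-reflexive (∑³-rotate _)) (∑-mono λ y → ∑-mono λ z →
      ≤-trans (≤-reflexive (sym (∑-* (𝟙 (W? (P y) (Q z))) _)))
        (≤-trans (*-monoˡ-≤ (𝟙 (W? (P y) (Q z))) (mult≤1 y z)) (≤-reflexive (*-identityˡ _))))

-- Iterated removal and the bound on triples

record Sparse {n : ℕ} (S : TripleSystem n) (d c t K : ℕ) : Set₁ where
  field
    P Q    : Fin n → Fin K
    D      : Fin K → Fin K → Set
    D?     : ∀ i j → Dec (D i j)
    -- The invariants after `t` rounds: edges have density at most 1/`d` in the removed set, whose
    -- area is at least `t` times n²/`c`.
    sparse : d * edges S P Q D? ≤ area P Q D?
    large  : t * (n * n) ≤ c * area P Q D?

nothing-removed : ∀ {n} (S : TripleSystem n) d c → Sparse S d c 0 1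
nothing-removed S d c = record
  { P = λ _ → zero ; Q = λ _ → zero ; D = λ _ _ → ⊥ ; D? = λ _ _ → no λ ()
  ; sparse = ≤-trans (≤-reflexive (trans (cong (d *_) (∑-zero λ y → ∑-zero λ z → refl)) (*-zeroʳ d))) z≤n
  ; large  = z≤n }

module _ (m : ℕ) (m≢0 : NonZero m) where

  -- Four kinds of triples are lost below, at most n²/d of each, so at least half of n²/m triples survive.
  private
    d c : ℕ
    d = 8 * m
    c = 2 * m * (d * d)

  remove-more : ∀ {n t K} (S : TripleSystem n) → n * n ≤ m * TripleSystem.size S → d * (K * (d * d)) ≤ n →
                Sparse S d c t K → Sparse S d c (suc t) (K * 2 ^ K)
  remove-more {n} {t} {K} S dense n-large σ = record
    { P = P′ ; Q = Q′ ; D = D′ ; D? = D′? ; sparse = sparse′ ; large = large′ }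
    where
    open Sparse σ
    open TripleSystem S using (size)
    open Refine S d (m*n≢0 8 m {{_}} {{m≢0}}) P Q D D?
    open ≤-Reasoning
    distrib₅ : ∀ d a b c e f → d * (a + (b + (c + (e + f)))) ≡ d * a + (d * b + (d * c + (d * e + d * f)))
    distrib₅ = solve-∀
    exchange : ∀ a b c → a * (b * c) ≡ b * (a * c)
    exchange = solve-∀
    eight : ∀ s → 4 * s + 4 * s ≡ 8 * s
    eight = solve-∀
    four : ∀ s w → s + (s + (s + (s + w))) ≡ 4 * s + w
    four = solve-∀
    split : ∀ m w → 8 * m * w ≡ 4 * (2 * m * w)
    split = solve-∀
    -- The triples account for 8n² and the four losses for at most 4n², so the remaining 4n² must
    -- come from `W`.
    total : 4 * (n * n) + 4 * (n * n) ≤ 4 * (n * n) + d * wArea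
    total = begin
      4 * (n * n) + 4 * (n * n)   ≡⟨ eight (n * n) ⟩
      8 * (n * n)                 ≤⟨ *-monoʳ-≤ 8 dense ⟩
      8 * (m * size)              ≡⟨ sym (*-assoc 8 m size) ⟩
      d * size                    ≤⟨ *-monoʳ-≤ d size-bound ⟩
      d * (edges S P Q D? + (leftLoss + (rightLoss + (thinLoss + wArea))))
        ≡⟨ distrib₅ d (edges S P Q D?) leftLoss rightLoss thinLoss wArea ⟩
      d * edges S P Q D? + (d * leftLoss + (d * rightLoss + (d * thinLoss + d * wArea)))
        ≤⟨ +-mono-≤ (≤-trans sparse (area≤n*n P Q D?)) (+-mono-≤ leftLoss-bound (+-mono-≤ rightLoss-bound (+-monoˡ-≤ (d * wArea) thin))) ⟩
      n * n + (n * n + (n * n + (n * n + d * wArea)))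
        ≡⟨ four (n * n) (d * wArea) ⟩
      4 * (n * n) + d * wArea     ∎
      where
      thin : d * thinLoss ≤ n * n
      thin = begin
        d * thinLoss              ≤⟨ *-monoʳ-≤ d thinLoss-bound ⟩
        d * (n * (K * (d * d)))   ≡⟨ exchange d n (K * (d * d)) ⟩
        n * (d * (K * (d * d)))   ≤⟨ *-monoʳ-≤ n n-large ⟩
        n * n                     ∎
    -- As `d` is `8 * m`, dividing the remaining 4n² by 4 gives n² ≤ 2m `wArea`; passing to `gain`
    -- costs the further factor `d * d` in `c`.
    progress : n * n ≤ c * gain
    progress = begin
      n * n                     ≤⟨ *-cancelˡ-≤ 4 (≤-trans (+-cancelˡ-≤ (4 * (n * n)) _ _ total) (≤-reflexive (split m wArea))) ⟩
      2 * m * wArea             ≤⟨ *-monoʳ-≤ (2 * m) wArea≤gain ⟩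
      2 * m * (d * d * gain)    ≡⟨ sym (*-assoc (2 * m) (d * d) gain) ⟩
      c * gain                  ∎
    sparse′ : d * edges S P′ Q′ D′? ≤ area P′ Q′ D′?
    sparse′ = begin
      d * edges S P′ Q′ D′?               ≡⟨ cong (d *_) edges′ ⟩
      d * (edges S P Q D? + gainEdges)    ≡⟨ *-distribˡ-+ d (edges S P Q D?) gainEdges ⟩
      d * edges S P Q D? + d * gainEdges  ≤⟨ +-mono-≤ sparse gain-sparse ⟩
      area P Q D? + gain                  ≡⟨ sym area′ ⟩
      area P′ Q′ D′?                      ∎
    large′ : suc t * (n * n) ≤ c * area P′ Q′ D′?
    large′ = begin
      n * n + t * (n * n)          ≤⟨ +-mono-≤ progress large ⟩
      c * gain + c * area P Q D?   ≡⟨ +-comm (c * gain) _ ⟩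
      c * area P Q D? + c * gain   ≡⟨ sym (*-distribˡ-+ c (area P Q D?) gain) ⟩
      c * (area P Q D? + gain)     ≡⟨ cong (c *_) (sym area′) ⟩
      c * area P′ Q′ D′?           ∎

  parts : ℕ → ℕ
  parts zero    = 1
  parts (suc t) = parts t * 2 ^ parts t

  -- Each round needs `n` large against its own number of parts, to keep the thin cells negligible.
  -- The initial 1 makes n² positive for the final contradiction.
  threshold : ℕ → ℕ
  threshold zero    = 1
  threshold (suc t) = threshold t ⊔ d * (parts t * (d * d))

  iterate : ∀ {n} (S : TripleSystem n) → n * n ≤ m * TripleSystem.size S →
            ∀ t → threshold t ≤ n → Sparse S d c t (parts t)
  iterate S dense zero    _ = nothing-removed S d c
  iterate S dense (suc t) h = remove-more S dense (m⊔n≤o⇒n≤o (threshold t) _ h) (iterate S dense t (m⊔n≤o⇒m≤o _ _ h))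

  1≤threshold : ∀ t → 1 ≤ threshold t
  1≤threshold zero    = ≤-refl
  1≤threshold (suc t) = ≤-trans (1≤threshold t) (m≤m⊔n _ _)

  -- After `suc c` rounds the removed area would be at least (c + 1)n²/c, more than the n²
  -- available.
  ruzsa-szemerédi : ∃ λ N → ∀ n → N ≤ n → (S : TripleSystem n) → m * TripleSystem.size S ≤ n * n
  ruzsa-szemerédi = threshold (suc c) , λ n h S → ≰⇒≥ (impossible n h S)
    where
    impossible : ∀ n → threshold (suc c) ≤ n → (S : TripleSystem n) → ¬ (n * n ≤ m * TripleSystem.size S)
    impossible n h S dense = <-irrefl refl (begin-strict
      c * (n * n)             <⟨ +-monoˡ-≤ (c * (n * n)) (*-mono-≤ 1≤n 1≤n) ⟩
      suc c * (n * n)         ≤⟨ large ⟩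
      c * area P Q D?         ≤⟨ *-monoʳ-≤ c (area≤n*n P Q D?) ⟩
      c * (n * n)             ∎)
      where
      open ≤-Reasoning
      open Sparse (iterate S dense (suc c) h)
      1≤n = ≤-trans (1≤threshold (suc c)) h

-- Independent sets and walks

enum : (I : Subset n) → Fin ∣ I ∣ → Fin n
enum (inside ∷ I)  zero    = zero
enum (inside ∷ I)  (suc i) = suc (enum I i)
enum (outside ∷ I) i       = suc (enum I i)

enum-∈ : (I : Subset n) (i : Fin ∣ I ∣) → enum I i ∈ I
enum-∈ (inside ∷ I)  zero    = here
enum-∈ (inside ∷ I)  (suc i) = there (enum-∈ I i)
enum-∈ (outside ∷ I) i       = there (enum-∈ I i)

enum-injective : (I : Subset n) → Injective _≡_ _≡_ (enum I)
enum-injective (inside ∷ I)  {zero}  {zero}  _  = refl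
enum-injective (inside ∷ I)  {suc i} {suc j} eq = cong suc (enum-injective I (suc-injective eq))
enum-injective (outside ∷ I) eq                 = enum-injective I (suc-injective eq)

rank : {I : Subset n} {x : Fin n} → x ∈ I → Fin ∣ I ∣
rank {I = inside ∷ _}  here        = zero
rank {I = inside ∷ _}  (there x∈I) = suc (rank x∈I)
rank {I = outside ∷ _} (there x∈I) = rank x∈I

enum-rank : {I : Subset n} {x : Fin n} (x∈I : x ∈ I) → enum I (rank x∈I) ≡ x
enum-rank {I = inside ∷ _}  here        = refl
enum-rank {I = inside ∷ _}  (there x∈I) = cong suc (enum-rank x∈I)
enum-rank {I = outside ∷ _} (there x∈I) = cong suc (enum-rank x∈I)

injective⇒≤∣∣ : {I : Subset n} (f : Fin r → Fin n) → Injective _≡_ _≡_ f → (∀ i → f i ∈ I) → r ≤ ∣ I ∣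
injective⇒≤∣∣ {I = I} f inj f∈I = injective⇒≤ {f = λ i → rank (f∈I i)} λ {i} {j} eq →
  inj (trans (sym (enum-rank (f∈I i))) (trans (cong (enum I) eq) (enum-rank (f∈I j))))

image : (Fin r → Fin n) → Subset n
image f = tabulate λ x → does (any? λ i → f i ≟ x)

image⁺ : (f : Fin r → Fin n) (i : Fin r) → f i ∈ image f
image⁺ f i = lookup⇒[]= (f i) (image f) (trans (lookup∘tabulate _ (f i)) (holds (any? λ j → f j ≟ f i)))
  where
  holds : (p? : Dec (∃ λ j → f j ≡ f i)) → does p? ≡ inside
  holds (yes _) = refl
  holds (no ¬p) = contradiction (i , refl) ¬p

image⁻ : (f : Fin r → Fin n) {x : Fin n} → x ∈ image f → ∃ λ i → f i ≡ x
image⁻ f {x} x∈f = witness (any? λ i → f i ≟ x) (trans (sym (lookup∘tabulate _ x)) ([]=⇒lookup x∈f))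
  where
  witness : (p? : Dec (∃ λ i → f i ≡ x)) → does p? ≡ inside → ∃ λ i → f i ≡ x
  witness (yes p) _ = p

∣image∣ : (f : Fin r → Fin n) → Injective _≡_ _≡_ f → ∣ image f ∣ ≡ r
∣image∣ f inj = ≤-antisym
  (injective⇒≤ {f = λ a → proj₁ (preimage a)} λ {a} {b} eq →
    enum-injective (image f) (trans (sym (proj₂ (preimage a))) (trans (cong f eq) (proj₂ (preimage b)))))
  (injective⇒≤∣∣ f inj (image⁺ f))
  where
  preimage : ∀ a → ∃ λ i → f i ≡ enum (image f) a
  preimage a = image⁻ f (enum-∈ (image f) a)

⊆∧∣∣≥⇒⊇ : {p q : Subset n} → p ⊆ q → ∣ q ∣ ≤ ∣ p ∣ → q ⊆ p
⊆∧∣∣≥⇒⊇ {p = p} p⊆q ∣q∣≤∣p∣ {x} x∈q with x ∈? p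
... | yes x∈p = x∈p
... | no x∉p  = contradiction ∣q∣≤∣p∣ (<⇒≱ (p⊂q⇒∣p∣<∣q∣ (p⊆q , x , x∈q , x∉p)))

module _ {n : ℕ} (G : Graph n) (k : ℕ) where

  isConfig? : ∀ I → Dec (IsConfig G k I)
  isConfig? I with ∣ I ∣ ℕ.≟ k | all? (λ u → all? λ v → independent? u v)
    where
    independent? : ∀ u v → Dec (u ∈ I → v ∈ I → Graph.adj G u v ≡ outside)
    independent? u v = (u ∈? I) →-dec (v ∈? I) →-dec (Graph.adj G u v Bool.≟ outside)
  ... | yes size | yes indep = yes ((λ u v → indep u v) , size)
  ... | no ¬size | _         = no λ (_ , size) → ¬size size
  ... | _        | no ¬indep = no λ (indep , _) → ¬indep indep

  -- Deciding walks of a given length, by searching all subsets, is what lets a shortest walk be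
  -- found constructively.
  walk? : ∀ l I J → Dec (Walk G k I J l)
  walk? zero I J with ≡-dec Bool._≟_ I J | isConfig? I
  ... | yes refl | yes cfg = yes (here cfg)
  ... | no I≢J   | _       = no λ { (here _) → I≢J refl }
  ... | _        | no ¬cfg = no λ { (here cfg) → ¬cfg cfg }
  walk? (suc l) I J with isConfig? I | anySubset? (λ L → (∣ I ∩ L ∣ ℕ.≟ k ∸ 1) ×-dec walk? l L J)
  ... | yes cfg | yes (L , adj , w) = yes (step cfg adj w)
  ... | no ¬cfg | _                 = no λ { (step cfg _ _) → ¬cfg cfg }
  ... | _       | no ¬next          = no λ { (step _ adj w) → ¬next (_ , adj , w) }

  append : ∀ {I J L a b} → Walk G k I J a → Walk G k J L b → Walk G k I L (a + b)
  append (here _)         w′ = w′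
  append (step cfg adj w) w′ = step cfg adj (append w w′)

  source-config : ∀ {I J l} → Walk G k I J l → IsConfig G k I
  source-config (here cfg)     = cfg
  source-config (step cfg _ _) = cfg

  splitWalk : ∀ {I J l} → Walk G k I J l → ∀ i → i ≤ l → ∃ λ L → Walk G k I L i × Walk G k L J (l ∸ i)
  splitWalk w              zero    _         = _ , here (source-config w) , w
  splitWalk (step cfg adj w) (suc i) (s≤s i≤l) with splitWalk w i i≤l
  ... | L , w₁ , w₂ = L , step cfg adj w₁ , w₂

  -- For configurations this means equal or adjacent. As an inequality it follows from exhibiting
  -- `k ∸ 1` distinct common vertices.
  Near : Subset n → Subset n → Set
  Near I J = k ∸ 1 ≤ ∣ I ∩ J ∣

  near-sym : ∀ I J → Near I J → Near J I
  near-sym I J = subst (λ L → k ∸ 1 ≤ ∣ L ∣) (∩-comm I J)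

  near⇒walk : ∀ {I J} → IsConfig G k I → IsConfig G k J → Near I J → ∃ λ a → a ≤ 1 × Walk G k I J a
  near⇒walk {I} {J} cI cJ near with ∣ I ∩ J ∣ ℕ.≟ k ∸ 1
  ... | yes adj = 1 , ≤-refl , step cI adj (here cJ)
  ... | no ¬adj = 0 , z≤n , subst (λ L → Walk G k I L 0) (⊆-antisym I⊆J J⊆I) (here cI)
    where
    k≤ : k ≤ ∣ I ∩ J ∣
    k≤ = ≤-trans (m≤n+m∸n k 1) (≤∧≢⇒< near (¬adj ∘ sym))
    I⊆J : I ⊆ J
    I⊆J = p∩q⊆q I J ∘ ⊆∧∣∣≥⇒⊇ (p∩q⊆p I J) (≤-trans (≤-reflexive (proj₂ cI)) k≤)
    J⊆I : J ⊆ I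
    J⊆I = p∩q⊆p I J ∘ ⊆∧∣∣≥⇒⊇ (p∩q⊆q I J) (≤-trans (≤-reflexive (proj₂ cJ)) k≤)

-- The separation met by vertices of a geodesic at pairwise distance at least three.
record Packing {n : ℕ} (G : Graph n) (k Q : ℕ) : Set where
  field
    node      : Fin Q → Subset n
    config    : ∀ q → IsConfig G k (node q)
    separated : ∀ {q q′ J} → IsConfig G k J → Near G k (node q) J → Near G k (node q′) J → q ≡ q′

-- The triple systems of a packing

module Link {n r Q : ℕ} (G : Graph n) (F : Packing G (3 + r) Q) where

  open Packing F

  k : ℕ
  k = 3 + r

  -- Transport along the size gives the index type `Fin k` with `k` = 3 + `r`, whose first three
  -- positions can be matched on.
  enumerate : (I : Subset n) → ∣ I ∣ ≡ k → ∃ λ (f : Fin k → Fin n) → Injective _≡_ _≡_ f × (∀ i → f i ∈ I)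
  enumerate I eq = subst (λ k → ∃ λ (f : Fin k → Fin n) → Injective _≡_ _≡_ f × (∀ i → f i ∈ I)) eq (enum I , enum-injective I , enum-∈ I)

  vert : Fin Q → Fin k → Fin n
  vert q = proj₁ (enumerate (node q) (proj₂ (config q)))

  vert-injective : ∀ q → Injective _≡_ _≡_ (vert q)
  vert-injective q = proj₁ (proj₂ (enumerate (node q) (proj₂ (config q))))

  vert-∈ : ∀ q i → vert q i ∈ node q
  vert-∈ q = proj₂ (proj₂ (enumerate (node q) (proj₂ (config q))))

  AgreeOff : Fin k → (Fin k → Fin n) → (Fin k → Fin n) → Set
  AgreeOff p f g = ∀ i → ¬ i ≡ p → f i ≡ g i

  -- The positions other than `p`, listed by `punchIn p`, give `k ∸ 1` distinct common vertices.
  agree⇒near : ∀ {q J} p (g : Fin k → Fin n) → (∀ i → g i ∈ J) → AgreeOff p (vert q) g → Near G k (node q) J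
  agree⇒near {q} {J} p g g∈J agree = injective⇒≤∣∣ (λ i → vert q (punchIn p i))
    (λ eq → punchIn-injective p _ _ (vert-injective q eq))
    (λ i → x∈p∩q⁺ (vert-∈ q _ , subst (_∈ J) (sym (agree (punchIn p i) (punchInᵢ≢i p i))) (g∈J _)))

  -- `node q′` itself serves as the configuration near both nodes.
  agree⇒≡ : ∀ {q q′} p → AgreeOff p (vert q) (vert q′) → q ≡ q′
  agree⇒≡ {q} {q′} p agree = separated (config q′)
    (agree⇒near p (vert q′) (vert-∈ q′) agree)
    (agree⇒near p (vert q′) (vert-∈ q′) λ _ _ → refl)

  X Y Z : Fin Q → Fin n
  X q = vert q 0F
  Y q = vert q 1F
  Z q = vert q 2F

  -- The `r` fixed vertices packed into one number, so that there are n^r classes of nodes.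
  key : Fin Q → Fin (n ^ r)
  key q = funToFin λ i → vert q (suc (suc (suc i)))

  key≡⇒ : ∀ {q q′} → key q ≡ key q′ → ∀ i → vert q (suc (suc (suc i))) ≡ vert q′ (suc (suc (suc i)))
  key≡⇒ {q} {q′} eq i = trans (sym (finToFun-funToFin (λ i → vert q (suc (suc (suc i)))) i))
    (trans (cong (λ c → finToFun c i) eq) (finToFun-funToFin (λ i → vert q′ (suc (suc (suc i)))) i))

  agree-xy : ∀ {q q′} → key q ≡ key q′ → X q ≡ X q′ → Y q ≡ Y q′ → AgreeOff 2F (vert q) (vert q′)
  agree-xy eq x y 0F                 _   = x
  agree-xy eq x y 1F                 _   = y
  agree-xy eq x y 2F                 2≢2 = contradiction refl 2≢2
  agree-xy eq x y (suc (suc (suc i))) _  = key≡⇒ eq i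

  agree-xz : ∀ {q q′} → key q ≡ key q′ → X q ≡ X q′ → Z q ≡ Z q′ → AgreeOff 1F (vert q) (vert q′)
  agree-xz eq x z 0F                 _   = x
  agree-xz eq x z 1F                 1≢1 = contradiction refl 1≢1
  agree-xz eq x z 2F                 _   = z
  agree-xz eq x z (suc (suc (suc i))) _  = key≡⇒ eq i

  agree-yz : ∀ {q q′} → key q ≡ key q′ → Y q ≡ Y q′ → Z q ≡ Z q′ → AgreeOff 0F (vert q) (vert q′)
  agree-yz eq y z 0F                 0≢0 = contradiction refl 0≢0
  agree-yz eq y z 1F                 _   = y
  agree-yz eq y z 2F                 _   = z
  agree-yz eq y z (suc (suc (suc i))) _  = key≡⇒ eq i

  -- Three nodes of one class cover the pairs xy, xz and yz. The hybrid `g` differs from each in at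
  -- most one position; being a configuration, it is near them and forces `q₁` and `q₂` to coincide.
  module Hybrid (q₁ q₂ q₃ : Fin Q) (key₂ : key q₁ ≡ key q₂) (key₃ : key q₁ ≡ key q₃) (x₁₂ : X q₁ ≡ X q₂) (y₁₃ : Y q₁ ≡ Y q₃) (z₂₃ : Z q₂ ≡ Z q₃) where

    g : Fin k → Fin n
    g 0F                  = X q₁
    g 1F                  = Y q₁
    g 2F                  = Z q₂
    g (suc (suc (suc i))) = vert q₁ (suc (suc (suc i)))

    agree₁ : AgreeOff 2F (vert q₁) g
    agree₁ 0F                  _   = refl
    agree₁ 1F                  _   = refl
    agree₁ 2F                  2≢2 = contradiction refl 2≢2
    agree₁ (suc (suc (suc i))) _   = refl

    agree₂ : AgreeOff 1F (vert q₂) g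
    agree₂ 0F                  _   = sym x₁₂
    agree₂ 1F                  1≢1 = contradiction refl 1≢1
    agree₂ 2F                  _   = refl
    agree₂ (suc (suc (suc i))) _   = sym (key≡⇒ key₂ i)

    agree₃ : AgreeOff 0F (vert q₃) g
    agree₃ 0F                  0≢0 = contradiction refl 0≢0
    agree₃ 1F                  _   = sym y₁₃
    agree₃ 2F                  _   = sym z₂₃
    agree₃ (suc (suc (suc i))) _   = sym (key≡⇒ key₃ i)

    -- Two indices always avoid one of the three exceptional positions.
    pair : ∀ i j → ∃ λ q → vert q i ≡ g i × vert q j ≡ g j
    pair i j with i ≟ 2F | j ≟ 2F
    ... | no i≢2   | no j≢2 = q₁ , agree₁ i i≢2 , agree₁ j j≢2
    ... | yes refl | _ with j ≟ 1F
    ...   | no j≢1   = q₂ , agree₂ 2F (λ ()) , agree₂ j j≢1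
    ...   | yes refl = q₃ , agree₃ 2F (λ ()) , agree₃ 1F (λ ())
    pair i j | no _ | yes refl with i ≟ 1F
    ...   | no i≢1   = q₂ , agree₂ i i≢1 , agree₂ 2F (λ ())
    ...   | yes refl = q₃ , agree₃ 1F (λ ()) , agree₃ 2F (λ ())

    -- Distinctness, like independence below, concerns two positions at a time and is inherited from
    -- the node that `pair` supplies.
    g-injective : Injective _≡_ _≡_ g
    g-injective {i} {j} eq with pair i j
    ... | q , qi , qj = vert-injective q (trans qi (trans eq (sym qj)))

    g-config : IsConfig G k (image g)
    g-config = independent , ∣image∣ g g-injective
      where
      independent : Independent G k (image g)
      independent u v u∈ v∈ with image⁻ g u∈ | image⁻ g v∈
      ... | i , refl | j , refl with pair i j
      ...   | q , qi , qj = trans (cong₂ (Graph.adj G) (sym qi) (sym qj)) (proj₁ (config q) _ _ (vert-∈ q i) (vert-∈ q j))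

    q₁≡q₂ : q₁ ≡ q₂
    q₁≡q₂ = separated g-config (agree⇒near 2F g (image⁺ g) agree₁) (agree⇒near 1F g (image⁺ g) agree₂)

  -- The order of the conditions follows the nested fibre sums in `fibre≤size`, so that the
  -- indicators multiply in the same shape.
  Triple : Fin (n ^ r) → Fin n → Fin n → Fin n → Fin Q → Set
  Triple u x y z q = Z q ≡ z × Y q ≡ y × X q ≡ x × key q ≡ u

  triple? : ∀ u x y z → Decidable (Triple u x y z)
  triple? u x y z q = (Z q ≟ z) ×-dec (Y q ≟ y) ×-dec (X q ≟ x) ×-dec (key q ≟ u)

  link : Fin (n ^ r) → TripleSystem n
  link u = record
    { T         = λ x y z → ∃ (Triple u x y z)
    ; T?        = λ x y z → any? (triple? u x y z)
    ; xy-unique = λ { (q , refl , refl , refl , refl) (q′ , refl , y , x , κ) → cong Z (agree⇒≡ 2F (agree-xy (sym κ) (sym x) (sym y))) }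
    ; xz-unique = λ { (q , refl , refl , refl , refl) (q′ , z , refl , x , κ) → cong Y (agree⇒≡ 1F (agree-xz (sym κ) (sym x) (sym z))) }
    ; yz-unique = λ { (q , refl , refl , refl , refl) (q′ , z , y , refl , κ) → cong X (agree⇒≡ 0F (agree-yz (sym κ) (sym y) (sym z))) }
    -- `q₁` already contains x and y; since the hybrid identifies it with `q₂`, its third vertex is
    -- z.
    ; closed    = λ { (q₁ , _ , refl , refl , refl) (q₂ , refl , _ , x₂ , κ₂) (q₃ , z₃ , y₃ , _ , κ₃) →
        q₁ , cong Z (Hybrid.q₁≡q₂ q₁ q₂ q₃ (sym κ₂) (sym κ₃) (sym x₂) (sym y₃) (sym z₃)) , refl , refl , refl }
    }

  triple-unique : ∀ u x y z q q′ → Triple u x y z q → Triple u x y z q′ → q ≡ q′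
  triple-unique u x y z q q′ (refl , refl , refl , refl) (_ , y′ , x′ , κ) = agree⇒≡ 2F (agree-xy (sym κ) (sym x′) (sym y′))

  -- By `triple-unique`, no triple of the link comes from two nodes.
  fibre≤size : ∀ u → ∑ (λ q → 𝟙 (key q ≟ u)) ≤ TripleSystem.size (link u)
  fibre≤size u = begin
    ∑ (λ q → 𝟙 (key q ≟ u))
      ≡⟨ ∑-fibres X (λ _ q → 𝟙 (key q ≟ u)) ⟩
    ∑ (λ x → ∑ λ q → 𝟙 (X q ≟ x) * 𝟙 (key q ≟ u))
      ≡⟨ ∑-cong (λ x → ∑-fibres Y λ _ q → 𝟙 (X q ≟ x) * 𝟙 (key q ≟ u)) ⟩
    ∑ (λ x → ∑ λ y → ∑ λ q → 𝟙 (Y q ≟ y) * (𝟙 (X q ≟ x) * 𝟙 (key q ≟ u)))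
      ≡⟨ ∑-cong (λ x → ∑-cong λ y → ∑-fibres Z λ _ q → 𝟙 (Y q ≟ y) * (𝟙 (X q ≟ x) * 𝟙 (key q ≟ u))) ⟩
    ∑³ (λ x y z → ∑ λ q → 𝟙 (Z q ≟ z) * (𝟙 (Y q ≟ y) * (𝟙 (X q ≟ x) * 𝟙 (key q ≟ u))))
      ≡⟨ ∑-cong (λ x → ∑-cong λ y → ∑-cong λ z → ∑-cong λ q → sym (𝟙-triple u x y z q)) ⟩
    ∑³ (λ x y z → ∑ λ q → 𝟙 (triple? u x y z q))
      ≤⟨ ∑³-mono (λ x y z → ∑-𝟙≤𝟙 (triple? u x y z) (any? (triple? u x y z)) (triple-unique u x y z)) ⟩
    TripleSystem.size (link u) ∎
    where
    open ≤-Reasoning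
    𝟙-triple : ∀ u x y z q → 𝟙 (triple? u x y z q) ≡ 𝟙 (Z q ≟ z) * (𝟙 (Y q ≟ y) * (𝟙 (X q ≟ x) * 𝟙 (key q ≟ u)))
    𝟙-triple u x y z q = trans (𝟙-× (Z q ≟ z) ((Y q ≟ y) ×-dec (X q ≟ x) ×-dec (key q ≟ u))) (cong (𝟙 (Z q ≟ z) *_)
      (trans (𝟙-× (Y q ≟ y) ((X q ≟ x) ×-dec (key q ≟ u))) (cong (𝟙 (Y q ≟ y) *_) (𝟙-× (X q ≟ x) (key q ≟ u)))))

  -- There are n^r keys, and each is shared by at most n²/`m` nodes.
  packing-bound : ∀ m → ((S : TripleSystem n) → m * TripleSystem.size S ≤ n * n) → m * Q ≤ n ^ (2 + r)
  packing-bound m bound = begin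
    m * Q
      ≡⟨ cong (m *_) (sym (∑-cell key)) ⟩
    m * ∑ (cell key)
      ≡⟨ *-∑ m _ ⟩
    ∑ (λ u → m * cell key u)
      ≤⟨ ∑≤n*k (n * n) (λ u → ≤-trans (*-monoʳ-≤ m (fibre≤size u)) (bound (link u))) ⟩
    n ^ r * (n * n)
      ≡⟨ rearrange (n ^ r) n ⟩
    n * (n * n ^ r) ∎
    where
    open ≤-Reasoning
    rearrange : ∀ a b → a * (b * b) ≡ b * (b * a)
    rearrange = solve-∀

-- Geodesics and the diameter bound

Geodesic : {n : ℕ} (G : Graph n) (k : ℕ) → Subset n → Subset n → ℕ → Set
Geodesic G k I J l = ∀ l′ → l′ < l → ¬ Walk G k I J l′

-- The nodes sit at positions 0, 3, 6 and so on up to `l`. A configuration near two of them would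
-- join them by a walk of length at most 2, a shortcut on the geodesic.
geodesic⇒packing : ∀ {n} {G : Graph n} {k I J l} → Walk G k I J l → Geodesic G k I J l → Packing G k (suc (l / 3))
geodesic⇒packing {n} {G} {k} {I} {J} {l} w geodesic = record
  { node      = node
  ; config    = λ q → source-config G k (tail-walk q)
  ; separated = λ {q} {q′} {L} → separated {q} {q′} {L}
  }
  where
  open ≤-Reasoning
  position≤l : (q : Fin (suc (l / 3))) → toℕ q * 3 ≤ l
  position≤l q = ≤-trans (*-monoˡ-≤ 3 (s≤s⁻¹ (toℕ<n q))) (m/n*n≤m l 3)
  split : (q : Fin (suc (l / 3))) → ∃ λ L → Walk G k I L (toℕ q * 3) × Walk G k L J (l ∸ toℕ q * 3)
  split q = splitWalk G k w (toℕ q * 3) (position≤l q)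
  node : Fin (suc (l / 3)) → Subset n
  node q = proj₁ (split q)
  tail-walk : ∀ q → Walk G k (node q) J (l ∸ toℕ q * 3)
  tail-walk q = proj₂ (proj₂ (split q))
  no-shortcut : ∀ {q q′} → toℕ q < toℕ q′ → ∀ {a} → a ≤ 2 → ¬ Walk G k (node q) (node q′) a
  no-shortcut {q} {q′} q<q′ {a} a≤2 v = geodesic _ shorter (append G k (proj₁ (proj₂ (split q))) (append G k v (tail-walk q′)))
    where
    shorter : toℕ q * 3 + (a + (l ∸ toℕ q′ * 3)) < l
    shorter = begin-strict
      toℕ q * 3 + (a + (l ∸ toℕ q′ * 3))   ≡⟨ sym (+-assoc (toℕ q * 3) a _) ⟩
      toℕ q * 3 + a + (l ∸ toℕ q′ * 3)     <⟨ +-monoˡ-< (l ∸ toℕ q′ * 3) (+-monoʳ-< (toℕ q * 3) (s≤s a≤2)) ⟩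
      toℕ q * 3 + 3 + (l ∸ toℕ q′ * 3)     ≡⟨ cong (_+ (l ∸ toℕ q′ * 3)) (+-comm (toℕ q * 3) 3) ⟩
      suc (toℕ q) * 3 + (l ∸ toℕ q′ * 3)   ≤⟨ +-monoˡ-≤ (l ∸ toℕ q′ * 3) (*-monoˡ-≤ 3 q<q′) ⟩
      toℕ q′ * 3 + (l ∸ toℕ q′ * 3)        ≡⟨ m+[n∸m]≡n (position≤l q′) ⟩
      l                                    ∎
  not-before : ∀ {q q′ L} → IsConfig G k L → Near G k (node q) L → Near G k (node q′) L → ¬ toℕ q < toℕ q′
  not-before {q} {q′} {L} cL near near′ q<q′
    with near⇒walk G k (source-config G k (tail-walk q)) cL near | near⇒walk G k cL (source-config G k (tail-walk q′)) (near-sym G k (node q′) L near′)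
  ... | _ , a≤1 , v | _ , b≤1 , v′ = no-shortcut q<q′ (+-mono-≤ a≤1 b≤1) (append G k v v′)
  separated : ∀ {q q′ L} → IsConfig G k L → Near G k (node q) L → Near G k (node q′) L → q ≡ q′
  separated {q} {q′} cL near near′ = toℕ-injective
    (≤-antisym (≮⇒≥ (not-before {q′} {q} cL near′ near)) (≮⇒≥ (not-before {q} {q′} cL near near′)))

-- Since l + 1 is at most three times `suc (l / 3)`, the triple bound with `m * 3` makes up for
-- keeping only every third configuration.
geodesic-bound : ∀ {n r m} {G : Graph n} {I J l} → ((S : TripleSystem n) → m * 3 * TripleSystem.size S ≤ n * n) →
                 Walk G (3 + r) I J l → Geodesic G (3 + r) I J l → m * suc l ≤ n ^ (2 + r)
geodesic-bound {n} {r} {m} {G} {l = l} bound w geodesic = begin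
  m * suc l                      ≡⟨ cong (λ l → m * suc l) (m≡m%n+[m/n]*n l 3) ⟩
  m * (suc (l % 3) + l / 3 * 3)  ≤⟨ *-monoʳ-≤ m (+-monoˡ-≤ (l / 3 * 3) (m%n<n l 3)) ⟩
  m * (suc (l / 3) * 3)          ≡⟨ rearrange m (suc (l / 3)) ⟩
  m * 3 * suc (l / 3)            ≤⟨ Link.packing-bound {r = r} G (geodesic⇒packing w geodesic) (m * 3) bound ⟩
  n ^ (2 + r)                    ∎
  where
  open ≤-Reasoning
  rearrange : ∀ a b → a * (b * 3) ≡ a * 3 * b
  rearrange = solve-∀

-- Descent on the length: pass to a shorter walk while there is one; when there is none, the walk is
-- a geodesic and `bound` applies.
shorten : ∀ {n} (G : Graph n) k b → (∀ {I J l} → Walk G k I J l → Geodesic G k I J l → l ≤ b) → ComponentDiamsAtMost G k b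
shorten G k b bound I J = <-rec (λ l → Walk G k I J l → ∃ λ l′ → Walk G k I J l′ × l′ ≤ b) go
  where
  go : ∀ l → (∀ {l′} → l′ < l → Walk G k I J l′ → ∃ λ l″ → Walk G k I J l″ × l″ ≤ b) → Walk G k I J l → ∃ λ l″ → Walk G k I J l″ × l″ ≤ b
  go l rec w with anyUpTo? (λ l′ → walk? G k l′ I J) l
  ... | yes (l′ , l′<l , w′) = rec l′<l w′
  ... | no none              = l , w , bound w λ l′ l′<l w′ → none (l′ , l′<l , w′)

mainTheorem1 : (k : ℕ) → 3 ≤ k → (m : ℕ) → 1 ≤ m →
    Σ ℕ (λ N → (n : ℕ) → N ≤ n →
    Σ ℕ (λ b → DAtMost n k b × m * b ≤ n ^ (k ∸ 1)))
mainTheorem1 (suc (suc (suc r))) (s≤s (s≤s (s≤s z≤n))) m@(suc _) _ = proj₁ rs , λ n N≤n →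
  -- Rounding down is harmless, as `l` is an integer; the same value serves all graphs on `n`
  -- vertices.
  n ^ (2 + r) / m ,
  (λ G → shorten G (3 + r) _ λ w geodesic →
    m*[1+l]≤a⇒l≤a/m (geodesic-bound {m = m} (proj₂ rs n N≤n) w geodesic)) ,
  ≤-trans (≤-reflexive (*-comm m _)) (m/n*n≤m (n ^ (2 + r)) m)
  where
  rs = ruzsa-szemerédi (m * 3) _
  m*[1+l]≤a⇒l≤a/m : ∀ {l a} → m * suc l ≤ a → l ≤ a / m
  m*[1+l]≤a⇒l≤a/m {l} {a} h = ≤-trans (n≤1+n l) (≤-trans (≤-reflexive (sym (m*n/n≡m (suc l) m))) (/-monoˡ-≤ m (≤-trans (≤-reflexive (*-comm (suc l) m)) h)))
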